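{- For $n\ge3$, $\max_{\pi\in S_n}\operatorname{sd}_{132}(\pi)=n-1$.
   Context: $S_n$ is the set of permutations of $[n]$ in one-line notation. Two sequences of distinct integers have the same relative order if replacing the $i$th smallest entry of each by $i$ yields the same word; a sequence contains $\sigma$ classically if some (not necessarily consecutive) subsequence has the same relative order as $\sigma$, and avoids it otherwise. $s_{132}:S_n\to S_n$ sends a permutation through a stack: at each step, if there is a next input entry and placing it on top of the stack would make the stack contents, read top to bottom, avoid $132$ classically, push it; otherwise pop the top entry of the stack to the end of the output; stop when the output has length $n$. For $\pi\in S_n$, $\operatorname{sd}_{132}(\pi)$ is the smallest nonnegative integer $t$ such that $s_{132}^t(\pi)$ avoids both $132$ and $231$ classically ($s_{132}^0$ is the identity map). -}

module Defs where

open import Data.Nat using (ℕ; zero; suc; _+_; _*_; _<ᵇ_; _<_; _≤_; _∸_)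
open import Data.Bool using (Bool; true; false; _∧_; _∨_; not; if_then_else_)
open import Data.List using (List; []; _∷_; _++_; map; length; upTo; zip; [_])
open import Data.Bool.ListAction using (any; all)
open import Data.Product using (_×_; _,_; Σ; ∃; ∃-syntax)
open import Data.List.Relation.Binary.Permutation.Propositional using (_↭_)
open import Relation.Binary.PropositionalEquality using (_≡_)
open import Relation.Nullary using (¬_)

IsPerm : ℕ → List ℕ → Set
IsPerm n π = π ↭ map suc (upTo n)

_⇔ᵇ_ : Bool → Bool → Bool
true ⇔ᵇ b = b
false ⇔ᵇ b = not b

sameOrder : List ℕ → List ℕ → Bool
sameOrder [] [] = true
sameOrder (x ∷ xs) (y ∷ ys) =
  all (λ p → ((x <ᵇ Data.Product.proj₁ p) ⇔ᵇ (y <ᵇ Data.Product.proj₂ p))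
           ∧ ((Data.Product.proj₁ p <ᵇ x) ⇔ᵇ (Data.Product.proj₂ p <ᵇ y)))
      (zip xs ys)
  ∧ sameOrder xs ys
sameOrder _ _ = false

subseqs : List ℕ → List (List ℕ)
subseqs [] = [] ∷ []
subseqs (x ∷ xs) = map (x ∷_) (subseqs xs) ++ subseqs xs

contains : List ℕ → List ℕ → Bool
contains σ π = any (λ s → sameOrder s σ) (subseqs π)

Avoids : List ℕ → List ℕ → Set
Avoids σ π = contains σ π ≡ false

p132 p231 : List ℕ
p132 = 1 ∷ 3 ∷ 2 ∷ []
p231 = 2 ∷ 3 ∷ 1 ∷ []

-- one run of the 132-avoiding stack.  The stack is a list whose head is the top,
-- so it is read top to bottom.  Arguments: fuel, remaining input, stack, output.
-- Each step either pushes (if the next input entry exists and the new stack,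
-- read top to bottom, avoids 132) or pops the top to the end of the output.
-- Fuel 2·|π| suffices (each entry is pushed once and popped once).
stackRun : ℕ → List ℕ → List ℕ → List ℕ → List ℕ
stackRun zero inp st out = out
stackRun (suc k) [] [] out = out
stackRun (suc k) [] (t ∷ st) out = stackRun k [] st (out ++ [ t ])
stackRun (suc k) (x ∷ xs) [] out = stackRun k xs (x ∷ []) out
stackRun (suc k) (x ∷ xs) (t ∷ st) out =
  if contains p132 (x ∷ t ∷ st)
  then stackRun k (x ∷ xs) st (out ++ [ t ])
  else stackRun k xs (x ∷ t ∷ st) out

s132 : List ℕ → List ℕ
s132 π = stackRun (2 * length π) π [] []

iter : ℕ → (List ℕ → List ℕ) → List ℕ → List ℕ
iter zero f π = π
iter (suc t) f π = f (iter t f π)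

AvoidsBoth : List ℕ → Set
AvoidsBoth π = Avoids p132 π × Avoids p231 π

SdIs : List ℕ → ℕ → Set
SdIs π t = AvoidsBoth (iter t s132 π) × (∀ u → u < t → ¬ AvoidsBoth (iter u s132 π))

{-# OPTIONS --safe #-}

-- Upper bound: after k ≥ 1 passes π = L ++ M ++ R, where M is a valley (decreasing, then increasing)
-- whose k entries are smaller than all others, and R is increasing.  While L is read some entries O
-- are popped; the first entry of M is then smaller than the whole stack and purges it down to its
-- longest increasing suffix B, after which nothing is popped until the input is exhausted.  The result
-- is O ++ reverse R ++ reverse M ++ B, in which the smallest entry of L ++ R is adjacent to reverse M
-- (if it lies in L, it is never popped before the end, so it is the head of B).  So M gains an entry
-- at every pass, and after n - 1 passes at most one entry is left outside M.
--
-- Lower bound: from the second pass on, a suitable permutation has L consisting of the decreasing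
-- lists of the remaining entries ≡ k + 1 and ≡ k + 2 (mod 3), while R is the increasing list of those
-- ≡ k (mod 3).  This shape is preserved with k + 1 for k, and k + 1, k + 2 and any entry of M form
-- a 231 as long as two entries are left outside M.
module Submission where

open import Defs
open import Data.Nat using (ℕ; zero; suc; _+_; _*_; _∸_; _≤_; _<_; _<ᵇ_; z≤n; s≤s)
open import Data.List
  using (List; []; _∷_; _++_; [_]; length; map; reverse; _ʳ++_; upTo; applyUpTo; applyDownFrom)
open import Data.Product using (_×_; _,_; Σ; ∃; ∃-syntax; proj₁; proj₂)
open import Data.Bool using (Bool; true; false; _∨_)
open import Data.Bool.ListAction using (any)
import Data.Bool.Properties as Bool
open import Data.List.Membership.Propositional using (_∈_)
open import Data.List.Membership.Propositional.Properties using (∈-++⁺ʳ; ∈-applyUpTo⁺; ∈-applyDownFrom⁺)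
open import Data.List.Properties
open import Data.List.Relation.Binary.Permutation.Propositional
  using (_↭_; ↭-refl; ↭-sym; ↭-trans; ↭-reflexive; ↭⇒↭ₛ; prep; swap; module PermutationReasoning)
open import Data.List.Relation.Binary.Permutation.Propositional.Properties
  using (All-resp-↭; ↭-length; shift; ++-comm; ↭-reverse)
  renaming (++⁺ˡ to ↭-++⁺ˡ; ++⁺ʳ to ↭-++⁺ʳ; ++⁺ to ↭-++⁺)
import Data.List.Relation.Binary.Permutation.Setoid.Properties as Setoid↭
open import Data.List.Relation.Binary.Sublist.Propositional
  using (_⊆_; []; _∷_; _∷ʳ_; ⊆-refl; minimum; from∈; to∈)
open import Data.List.Relation.Binary.Sublist.Propositional.Properties using (reverse⁺; ++⁺ˡ; ++⁺ʳ; ++⁺; ∷ˡ⁻)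
open import Data.List.Relation.Unary.All as All using (All; []; _∷_)
import Data.List.Relation.Unary.All.Properties as All
open import Data.List.Relation.Unary.AllPairs as AllPairs using (AllPairs; []; _∷_)
import Data.List.Relation.Unary.AllPairs.Properties as AllPairs
open import Data.List.Relation.Unary.Any using (here; there)
open import Data.Nat.Properties
open import Data.Nat.Tactic.RingSolver using (solve-∀)
open import Data.Sum using (inj₁; inj₂)
open import Function using (_∘_; id)
open import Relation.Binary.Definitions using (tri<; tri≈; tri>)
open import Relation.Binary.PropositionalEquality
  using (_≡_; _≢_; refl; sym; trans; cong; cong₂; subst; setoid; module ≡-Reasoning)
open import Relation.Nullary using (¬_; Dec; yes; no; contradiction)
open import Relation.Nullary.Decidable using (map′; _×-dec_)

-- Containment of 132 and 231 as sublist conditions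

<ᵇ-true : ∀ {m n} → m < n → (m <ᵇ n) ≡ true
<ᵇ-true {zero} {suc n} _ = refl
<ᵇ-true {suc m} {suc n} (s≤s m<n) = <ᵇ-true m<n

<ᵇ-false : ∀ {m n} → n ≤ m → (m <ᵇ n) ≡ false
<ᵇ-false {m} {zero} _ = refl
<ᵇ-false {suc m} {suc n} (s≤s n≤m) = <ᵇ-false n≤m

<ᵇ-true⁻¹ : ∀ {m n} → (m <ᵇ n) ≡ true → m < n
<ᵇ-true⁻¹ {zero} {suc n} _ = s≤s z≤n
<ᵇ-true⁻¹ {suc m} {suc n} eq = s≤s (<ᵇ-true⁻¹ eq)

any-++ : ∀ (f : List ℕ → Bool) ss {ts} → any f ss ≡ false → any f ts ≡ false → any f (ss ++ ts) ≡ false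
any-++ f [] _ q = q
any-++ f (s ∷ ss) p q with f s
... | false = any-++ f ss p q

any-++⁻ : ∀ (f : List ℕ → Bool) ss {ts} → any f (ss ++ ts) ≡ false → any f ss ≡ false × any f ts ≡ false
any-++⁻ f [] q = refl , q
any-++⁻ f (s ∷ ss) q with f s
... | false = any-++⁻ f ss q

any-map : ∀ (f : List ℕ → Bool) (g : List ℕ → List ℕ) ss → any f (map g ss) ≡ any (f ∘ g) ss
any-map f g [] = refl
any-map f g (s ∷ ss) = cong (f (g s) ∨_) (any-map f g ss)

-- The test `f` is arbitrary because the induction passes to `f ∘ (x ∷_)` for the sublists that use
-- the head.
any-subseqs⁺ : ∀ (f : List ℕ → Bool) xs → (∀ {s} → s ⊆ xs → f s ≡ false) → any f (subseqs xs) ≡ false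
any-subseqs⁺ f [] h rewrite h [] = refl
any-subseqs⁺ f (x ∷ xs) h = any-++ f (map (x ∷_) (subseqs xs))
  (trans (any-map f (x ∷_) (subseqs xs)) (any-subseqs⁺ (f ∘ (x ∷_)) xs (h ∘ (refl ∷_))))
  (any-subseqs⁺ f xs (h ∘ (x ∷ʳ_)))

any-subseqs⁻ : ∀ (f : List ℕ → Bool) {s xs} → any f (subseqs xs) ≡ false → s ⊆ xs → f s ≡ false
any-subseqs⁻ f h [] = Bool.∨-conicalˡ _ _ h
any-subseqs⁻ f {xs = x ∷ xs} h (.x ∷ʳ τ) =
  any-subseqs⁻ f (proj₂ (any-++⁻ f (map (x ∷_) (subseqs xs)) h)) τ
any-subseqs⁻ f {xs = x ∷ xs} h (refl ∷ τ) =
  any-subseqs⁻ (f ∘ (x ∷_)) (trans (sym (any-map f (x ∷_) (subseqs xs)))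
    (proj₁ (any-++⁻ f (map (x ∷_) (subseqs xs)) h))) τ

sameOrder-length : ∀ xs ys → sameOrder xs ys ≡ true → length xs ≡ length ys
sameOrder-length [] [] _ = refl
sameOrder-length (x ∷ xs) (y ∷ ys) eq = cong suc (sameOrder-length xs ys (Bool.∧-conicalʳ _ _ eq))

-- The weak inequalities negate `c < b` and `a < b`, so no distinctness has to be carried along.
Av132 Av231 : List ℕ → Set
Av132 xs = ∀ {a b c} → (a ∷ b ∷ c ∷ []) ⊆ xs → a < c → b ≤ c
Av231 xs = ∀ {a b c} → (a ∷ b ∷ c ∷ []) ⊆ xs → c < a → b ≤ a

sameOrder-132⁻ : ∀ a b c → sameOrder (a ∷ b ∷ c ∷ []) p132 ≡ true → a < c × c < b
sameOrder-132⁻ a b c eq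
  -- Any other outcome of the six comparisons makes `eq` absurd.
  with true ← a <ᵇ b | false ← b <ᵇ a | true ← a <ᵇ c in a<c | false ← c <ᵇ a
     | false ← b <ᵇ c | true ← c <ᵇ b in c<b
  = <ᵇ-true⁻¹ a<c , <ᵇ-true⁻¹ c<b

sameOrder-231⁻ : ∀ a b c → sameOrder (a ∷ b ∷ c ∷ []) p231 ≡ true → a < b × c < a
sameOrder-231⁻ a b c eq
  with true ← a <ᵇ b in a<b | false ← b <ᵇ a | false ← a <ᵇ c | true ← c <ᵇ a in c<a
  = <ᵇ-true⁻¹ a<b , <ᵇ-true⁻¹ c<a

avoids-3⁺ : ∀ {x y z} xs →
  (∀ {a b c} → (a ∷ b ∷ c ∷ []) ⊆ xs → sameOrder (a ∷ b ∷ c ∷ []) (x ∷ y ∷ z ∷ []) ≢ true) →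
  Avoids (x ∷ y ∷ z ∷ []) xs
avoids-3⁺ {x} {y} {z} xs h = any-subseqs⁺ _ xs λ {s} τ → Bool.¬-not (no-match s τ)
  where
  no-match : ∀ s → s ⊆ xs → sameOrder s (x ∷ y ∷ z ∷ []) ≢ true
  no-match s τ eq with s | τ | eq | sameOrder-length s _ eq
  ... | _ ∷ _ ∷ _ ∷ [] | τ′ | eq′ | refl = h τ′ eq′

av132⇒avoids : ∀ {xs} → Av132 xs → Avoids p132 xs
av132⇒avoids {xs} av = avoids-3⁺ xs λ {a} {b} {c} τ eq →
  let (a<c , c<b) = sameOrder-132⁻ a b c eq in <⇒≱ c<b (av τ a<c)

av231⇒avoids : ∀ {xs} → Av231 xs → Avoids p231 xs
av231⇒avoids {xs} av = avoids-3⁺ xs λ {a} {b} {c} τ eq →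
  let (a<b , c<a) = sameOrder-231⁻ a b c eq in <⇒≱ a<b (av τ c<a)

avoids⇒av132 : ∀ {xs} → Avoids p132 xs → Av132 xs
avoids⇒av132 avoids {a} {b} {c} τ a<c with <-≤-connex c b
... | inj₂ b≤c = b≤c
... | inj₁ c<b = contradiction (trans (sym matches) (any-subseqs⁻ _ avoids τ)) λ ()
  where
  matches : sameOrder (a ∷ b ∷ c ∷ []) p132 ≡ true
  matches
    rewrite <ᵇ-true (<-trans a<c c<b) | <ᵇ-false (<⇒≤ (<-trans a<c c<b))
          | <ᵇ-true a<c | <ᵇ-false (<⇒≤ a<c) | <ᵇ-true c<b | <ᵇ-false (<⇒≤ c<b) = refl

avoids⇒av231 : ∀ {xs} → Avoids p231 xs → Av231 xs
avoids⇒av231 avoids {a} {b} {c} τ c<a with <-≤-connex a b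
... | inj₂ b≤a = b≤a
... | inj₁ a<b = contradiction (trans (sym matches) (any-subseqs⁻ _ avoids τ)) λ ()
  where
  matches : sameOrder (a ∷ b ∷ c ∷ []) p231 ≡ true
  matches
    rewrite <ᵇ-true a<b | <ᵇ-false (<⇒≤ a<b) | <ᵇ-true c<a | <ᵇ-false (<⇒≤ c<a)
          | <ᵇ-true (<-trans c<a a<b) | <ᵇ-false (<⇒≤ (<-trans c<a a<b)) = refl

-- Increasing lists, valleys and the condition for a push

allPairs-⊆⁺ : ∀ {R : ℕ → ℕ → Set} {xs} →
  (∀ {b c} → (b ∷ c ∷ []) ⊆ xs → R b c) → AllPairs R xs
allPairs-⊆⁺ {xs = []} h = []
allPairs-⊆⁺ {xs = x ∷ xs} h =
  All.tabulate (λ c∈xs → h (refl ∷ from∈ c∈xs)) ∷ allPairs-⊆⁺ (h ∘ (x ∷ʳ_))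

allPairs-⊆⁻ : ∀ {R : ℕ → ℕ → Set} {b c xs} → AllPairs R xs → (b ∷ c ∷ []) ⊆ xs → R b c
allPairs-⊆⁻ (_ ∷ rs) (_ ∷ʳ τ) = allPairs-⊆⁻ rs τ
allPairs-⊆⁻ (r ∷ _) (refl ∷ τ) = All.lookup r (to∈ τ)

-- No pair of the stack completes a 132 that starts with `x`: on a 132-avoiding stack this is
-- exactly the condition for pushing `x`.
Fits : ℕ → List ℕ → Set
Fits x = AllPairs (λ b c → x < c → b ≤ c)

Sorted : List ℕ → Set
Sorted = AllPairs _≤_

sorted⇒fits : ∀ {x xs} → Sorted xs → Fits x xs
sorted⇒fits = AllPairs.map (λ b≤c _ → b≤c)

-- For an `x` below the whole stack the premise `x < c` always holds, so such an `x` can only rest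
-- on an increasing stack. This is what purges the stack.
fits⇒sorted : ∀ {x xs} → All (x <_) xs → Fits x xs → Sorted xs
fits⇒sorted [] [] = []
fits⇒sorted (_ ∷ x<xs) (fs ∷ fits) =
  All.zipWith (λ (f , x<c) → f x<c) (fs , x<xs) ∷ fits⇒sorted x<xs fits

av132-∷ : ∀ {x xs} → Fits x xs → Av132 xs → Av132 (x ∷ xs)
av132-∷ fits av (_ ∷ʳ τ) = av τ
av132-∷ fits av (refl ∷ τ) = allPairs-⊆⁻ fits τ

av132-head : ∀ {x xs} → Av132 (x ∷ xs) → Fits x xs
av132-head av = allPairs-⊆⁺ (λ τ → av (refl ∷ τ))

av132-tail : ∀ {x xs} → Av132 (x ∷ xs) → Av132 xs
av132-tail av τ = av (_ ∷ʳ τ)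

av132? : ∀ xs → Dec (Av132 xs)
av132? xs = map′ avoids⇒av132 av132⇒avoids (contains p132 xs Bool.≟ false)

sorted⇒av132 : ∀ {xs} → Sorted xs → Av132 xs
sorted⇒av132 (_ ∷ sorted) (_ ∷ʳ τ) = sorted⇒av132 sorted τ
sorted⇒av132 (_ ∷ sorted) (refl ∷ τ) _ = allPairs-⊆⁻ sorted τ

-- A 132 that meets `ys` ends in `ys`, but there each entry is at least every entry before it.
av132-++ : ∀ {xs ys} → Av132 xs → Sorted ys → All (λ x → All (x ≤_) ys) xs → Av132 (xs ++ ys)
av132-++ {[]} av sorted [] = sorted⇒av132 sorted
av132-++ {x ∷ xs} av sorted (_ ∷ xs≤ys) = av132-∷
  (AllPairs.++⁺ (av132-head av) (sorted⇒fits sorted) (All.map (All.map (λ b≤c _ → b≤c)) xs≤ys))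
  (av132-++ (av132-tail av) sorted xs≤ys)

-- Each `r` is at least every entry of `xs`, so a 132 starting with `r` ends in the increasing `ys`,
-- at an entry no smaller than any before it in `xs ++ ys`. Then `r` joins `xs`. The entries of `rs`
-- and `ys` may interleave in size.
av132-ʳ++ : ∀ {rs xs ys} → Sorted rs → All (λ x → All (x ≤_) rs) xs → Sorted ys →
  Av132 (xs ++ ys) → Av132 (rs ʳ++ (xs ++ ys))
av132-ʳ++ [] _ _ av = av
av132-ʳ++ {r ∷ rs} {xs} (r≤rs ∷ sorted) xs≤ sortedʸ av =
  av132-ʳ++ {rs} {r ∷ xs} sorted (r≤rs ∷ All.map All.tail xs≤) sortedʸ (av132-∷ r-fits av)
  where
  xs≤r = All.map All.head xs≤
  r-fits : Fits r (xs ++ _)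
  r-fits = AllPairs.++⁺
    (allPairs-⊆⁺ λ τ r<c → contradiction (All.lookup xs≤r (to∈ (∷ˡ⁻ τ))) (<⇒≱ r<c))
    (sorted⇒fits sortedʸ)
    (All.map (λ b≤r → All.universal (λ _ r<c → ≤-trans b≤r (<⇒≤ r<c)) _) xs≤r)

-- Built from the inside out, with a largest entry added at either end: reversal swaps the two
-- constructors, and absorbing an entry into the core is a single constructor.
data Valley : List ℕ → Set where
  [] : Valley []
  _◂_ : ∀ {x xs} → All (_≤ x) xs → Valley xs → Valley (x ∷ xs)
  _▸_ : ∀ {x xs} → All (_≤ x) xs → Valley xs → Valley (xs ++ [ x ])

valley-reverse : ∀ {xs} → Valley xs → Valley (reverse xs)
valley-reverse [] = []
valley-reverse {x ∷ xs} (xs≤x ◂ v) = subst Valley (sym (unfold-reverse x xs))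
  (All-resp-↭ (↭-sym (↭-reverse xs)) xs≤x ▸ valley-reverse v)
valley-reverse (_▸_ {x} {xs} xs≤x v) = subst Valley (sym (reverse-++ xs [ x ]))
  (All-resp-↭ (↭-sym (↭-reverse xs)) xs≤x ◂ valley-reverse v)

valley⇒av132 : ∀ {xs} → Valley xs → Av132 xs
valley⇒av132 [] ()
valley⇒av132 (xs≤x ◂ v) = av132-∷
  (allPairs-⊆⁺ λ τ x<c → contradiction (All.lookup xs≤x (to∈ (∷ˡ⁻ τ))) (<⇒≱ x<c))
  (valley⇒av132 v)
valley⇒av132 (xs≤x ▸ v) = av132-++ (valley⇒av132 v) ([] ∷ []) (All.map (_∷ []) xs≤x)

-- 231 is the reverse of 132, and valleys are closed under reversal.
valley⇒avoidsBoth : ∀ {xs} → Valley xs → AvoidsBoth xs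
valley⇒avoidsBoth {xs} v = av132⇒avoids (valley⇒av132 v) ,
  av231⇒avoids {xs} (λ τ → valley⇒av132 (valley-reverse v) (reverse⁺ τ))

-- The stack machine

-- Opaque, so that unification never looks inside the fuel.
opaque
  run : List ℕ → List ℕ → List ℕ → List ℕ
  run inp st out = stackRun (2 * length inp + length st) inp st out

opaque
  unfolding run

  s132≡run : ∀ π → s132 π ≡ run π [] []
  s132≡run π = cong (λ k → stackRun k π [] []) (sym (+-identityʳ (2 * length π)))

  run-push : ∀ {x inp st out} → Av132 (x ∷ st) → run (x ∷ inp) st out ≡ run inp (x ∷ st) out
  run-push {x} {inp} {st} {out} av = trans (cong (λ k → stackRun k (x ∷ inp) st out) fuel) (push st av)
    where
    l : ℕ
    l = length inp
    -- The fuel counts two steps per input entry and one per stack entry, so a push lowers it by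
    -- exactly one.
    fuel : 2 * suc l + length st ≡ suc (2 * l + suc (length st))
    fuel = trans (cong (_+ length st) (*-suc 2 l)) (cong suc (sym (+-suc (2 * l) (length st))))
    push : ∀ {k} st → Av132 (x ∷ st) → stackRun (suc k) (x ∷ inp) st out ≡ stackRun k inp (x ∷ st) out
    push [] _ = refl
    push (t ∷ st) av rewrite av132⇒avoids av = refl

  run-pop : ∀ {x inp t st out} → ¬ Av132 (x ∷ t ∷ st) →
    run (x ∷ inp) (t ∷ st) out ≡ run (x ∷ inp) st (out ++ [ t ])
  run-pop {x} {inp} {t} {st} {out} ¬av =
    trans (cong (λ k → stackRun k (x ∷ inp) (t ∷ st) out) (+-suc (2 * suc (length inp)) (length st)))
      (pop (2 * suc (length inp) + length st))
    where
    pop : ∀ k → stackRun (suc k) (x ∷ inp) (t ∷ st) out ≡ stackRun k (x ∷ inp) st (out ++ [ t ])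
    pop k rewrite Bool.¬-not (¬av ∘ avoids⇒av132) = refl

  run-end : ∀ st out → run [] st out ≡ out ++ st
  run-end [] out = sym (++-identityʳ out)
  run-end (t ∷ st) out = trans (run-end st (out ++ [ t ])) (++-assoc out [ t ] st)

av132-ʳ++⁻ : ∀ xs {st} → Av132 (xs ʳ++ st) → Av132 st
av132-ʳ++⁻ [] av = av
av132-ʳ++⁻ (x ∷ xs) av = av132-tail (av132-ʳ++⁻ xs av)

-- Every intermediate stack is a suffix of the final one, so checking the final stack suffices.
run-pushAll : ∀ xs {inp st out} → Av132 (xs ʳ++ st) → run (xs ++ inp) st out ≡ run inp (xs ʳ++ st) out
run-pushAll [] av = refl
run-pushAll (x ∷ xs) av = trans (run-push (av132-ʳ++⁻ xs av)) (run-pushAll xs av)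

-- Popping stops at `C` at the latest, because `x` can be pushed there. So `C` is protected, and the
-- popped entries form a prefix `O` of `P`.
run-insert : ∀ x inp P C out → Av132 (P ++ C) → Fits x C →
  ∃[ O ] ∃[ P′ ] P ≡ O ++ P′ × Av132 (x ∷ P′ ++ C) ×
    run (x ∷ inp) (P ++ C) out ≡ run inp (x ∷ P′ ++ C) (out ++ O)
run-insert x inp [] C out av fits = [] , [] , refl , av′ ,
  trans (run-push av′) (cong (run inp (x ∷ C)) (sym (++-identityʳ out)))
  where av′ = av132-∷ fits av
run-insert x inp (t ∷ P) C out av fits with av132? (x ∷ t ∷ P ++ C)
... | yes av′ = [] , t ∷ P , refl , av′ ,
  trans (run-push av′) (cong (run inp _) (sym (++-identityʳ out)))
... | no ¬av =
  let O , P′ , eq , av′ , runs = run-insert x inp P C (out ++ [ t ]) (av132-tail av) fits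
  in t ∷ O , P′ , cong (t ∷_) eq , av′ ,
     trans (run-pop ¬av) (trans runs (cong (run inp _) (++-assoc out [ t ] O)))

-- All of `X` fits the protected `C`, so only `P` changes. Popped and retained entries are tracked
-- up to order only, which is enough for the upper bound.
run-load : ∀ X inp P C out → Av132 (P ++ C) → All (λ x → Fits x C) X →
  ∃[ O ] ∃[ P′ ] O ++ P′ ↭ X ++ P × Av132 (P′ ++ C) ×
    run (X ++ inp) (P ++ C) out ≡ run inp (P′ ++ C) (out ++ O)
run-load [] inp P C out av [] = [] , P , ↭-refl , av , cong (run inp _) (sym (++-identityʳ out))
run-load (x ∷ X) inp P C out av (fits ∷ fitss)
  with run-insert x (X ++ inp) P C out av fits
... | O₁ , P₁ , refl , av₁ , runs₁
  with run-load X inp (x ∷ P₁) C (out ++ O₁) av₁ fitss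
... | O₂ , P₂ , perm , av₂ , runs₂ = O₁ ++ O₂ , P₂ , perm′ , av₂ ,
  trans runs₁ (trans runs₂ (cong (run inp _) (++-assoc out O₁ O₂)))
  where
  open PermutationReasoning
  perm′ : (O₁ ++ O₂) ++ P₂ ↭ x ∷ X ++ O₁ ++ P₁
  perm′ = begin
    (O₁ ++ O₂) ++ P₂     ≡⟨ ++-assoc O₁ O₂ P₂ ⟩
    O₁ ++ O₂ ++ P₂       ↭⟨ ↭-++⁺ˡ O₁ perm ⟩
    O₁ ++ X ++ x ∷ P₁    ↭⟨ ↭-++⁺ˡ O₁ (shift x X P₁) ⟩
    O₁ ++ x ∷ X ++ P₁    ↭⟨ shift x O₁ (X ++ P₁) ⟩
    x ∷ O₁ ++ X ++ P₁    ↭⟨ prep x (↭-++⁺ˡ O₁ (++-comm X P₁)) ⟩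
    x ∷ O₁ ++ P₁ ++ X    ≡⟨ cong (x ∷_) (++-assoc O₁ P₁ X) ⟨
    x ∷ (O₁ ++ P₁) ++ X  ↭⟨ prep x (++-comm (O₁ ++ P₁) X) ⟩
    x ∷ X ++ O₁ ++ P₁    ∎

-- Being smallest, `m` leaves only an increasing `B` below it. Then every later entry fits `m ∷ B`,
-- so `m` is not popped while `L₂` is read.
run-load-min : ∀ L₁ m L₂ inp → All (m <_) (L₁ ++ L₂) →
  ∃[ O ] ∃[ P ] ∃[ B ] (O ++ P) ++ B ↭ L₁ ++ L₂ × Sorted B × Av132 (P ++ m ∷ B) ×
    run ((L₁ ++ m ∷ L₂) ++ inp) [] [] ≡ run inp (P ++ m ∷ B) O
run-load-min L₁ m L₂ inp m<
  with run-load L₁ (m ∷ L₂ ++ inp) [] [] [] (λ ()) (All.universal (λ _ → []) L₁)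
... | O₁ , P₁ , perm₁ , av₁ , runs₁
  with run-insert m (L₂ ++ inp) P₁ [] O₁ av₁ []
... | O₂ , B , refl , av₂ , runs₂ = result
  where
  B′ = B ++ []
  m<B : All (m <_) B′
  m<B = All.++⁺ (All.++⁻ʳ O₂ (All.++⁻ʳ O₁
    (All-resp-↭ (↭-sym perm₁) (All.++⁺ (All.++⁻ˡ L₁ m<) [])))) []
  sorted : Sorted B′
  sorted = fits⇒sorted m<B (av132-head av₂)
  result : ∃[ O ] ∃[ P ] ∃[ B ] (O ++ P) ++ B ↭ L₁ ++ L₂ × Sorted B × Av132 (P ++ m ∷ B) ×
    run ((L₁ ++ m ∷ L₂) ++ inp) [] [] ≡ run inp (P ++ m ∷ B) O
  result
    with run-load L₂ inp [] (m ∷ B′) (O₁ ++ O₂) av₂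
           (All.universal (λ _ → sorted⇒fits (All.map <⇒≤ m<B ∷ sorted)) L₂)
  ... | O₃ , P , perm₃ , av₃ , runs₃ = (O₁ ++ O₂) ++ O₃ , P , B′ , perm , sorted , av₃ ,
    trans (cong (λ i → run i [] []) (++-assoc L₁ (m ∷ L₂) inp)) (trans runs₁ (trans runs₂ runs₃))
    where
    open PermutationReasoning
    perm : (((O₁ ++ O₂) ++ O₃) ++ P) ++ B′ ↭ L₁ ++ L₂
    perm = begin
      (((O₁ ++ O₂) ++ O₃) ++ P) ++ B′  ≡⟨ cong (_++ B′) (++-assoc (O₁ ++ O₂) O₃ P) ⟩
      ((O₁ ++ O₂) ++ O₃ ++ P) ++ B′    ≡⟨ ++-assoc (O₁ ++ O₂) (O₃ ++ P) B′ ⟩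
      (O₁ ++ O₂) ++ (O₃ ++ P) ++ B′    ↭⟨ ↭-++⁺ˡ (O₁ ++ O₂) (++-comm (O₃ ++ P) B′) ⟩
      (O₁ ++ O₂) ++ B′ ++ O₃ ++ P      ≡⟨ ++-assoc (O₁ ++ O₂) B′ (O₃ ++ P) ⟨
      ((O₁ ++ O₂) ++ B′) ++ O₃ ++ P    ≡⟨ cong (_++ (O₃ ++ P))
        (trans (cong ((O₁ ++ O₂) ++_) (++-identityʳ B)) (++-assoc O₁ O₂ B)) ⟩
      (O₁ ++ O₂ ++ B) ++ O₃ ++ P       ↭⟨ ↭-++⁺ perm₁ perm₃ ⟩
      (L₁ ++ []) ++ L₂ ++ []           ≡⟨ cong₂ _++_ (++-identityʳ L₁) (++-identityʳ L₂) ⟩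
      L₁ ++ L₂                         ∎

-- Nothing is popped: the reversed core is a valley lying below the increasing `B`, and `R` is
-- increasing and no smaller than the core.
run-finish : ∀ y M R B O → Valley (y ∷ M) → Sorted R → Sorted B →
  All (λ x → All (x ≤_) R) (y ∷ M) → All (λ x → All (x ≤_) B) (y ∷ M) →
  run (M ++ R) (y ∷ B) O ≡ O ++ reverse R ++ reverse (y ∷ M) ++ B
run-finish y M R B O valley sortedR sortedB M≤R M≤B = begin
  run (M ++ R) (y ∷ B) O                 ≡⟨ cong (λ i → run i (y ∷ B) O) (++-identityʳ (M ++ R)) ⟨
  run ((M ++ R) ++ []) (y ∷ B) O         ≡⟨ run-pushAll (M ++ R) (subst Av132 (sym stack) av) ⟩
  run [] ((M ++ R) ʳ++ (y ∷ B)) O        ≡⟨ run-end _ O ⟩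
  O ++ (M ++ R) ʳ++ (y ∷ B)              ≡⟨ cong (O ++_) (trans stack (ʳ++-defn R)) ⟩
  O ++ reverse R ++ reverse (y ∷ M) ++ B ∎
  where
  open ≡-Reasoning
  flip-M : ∀ {P : ℕ → Set} → All P (y ∷ M) → All P (reverse (y ∷ M))
  flip-M = All-resp-↭ (↭-sym (↭-reverse (y ∷ M)))
  stack : (M ++ R) ʳ++ (y ∷ B) ≡ R ʳ++ (reverse (y ∷ M) ++ B)
  stack = trans (++-ʳ++ M) (cong (R ʳ++_) (ʳ++-defn (y ∷ M)))
  av : Av132 (R ʳ++ (reverse (y ∷ M) ++ B))
  av = av132-ʳ++ sortedR (flip-M M≤R) sortedB
    (av132-++ (valley⇒av132 (valley-reverse valley)) sortedB (flip-M M≤B))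

-- The core absorbs the smallest outside entry at every pass

-- The order within `left` is not tracked; `right` is increasing so that it can be pushed without a
-- pop.
record Stage (q : ℕ) (π : List ℕ) : Set where
  constructor stage
  field
    {left core right} : List ℕ
    split    : π ≡ left ++ core ++ right
    nonempty : 0 < length core
    valley   : Valley core
    sorted   : Sorted right
    unique   : AllPairs _≢_ (left ++ right)
    below    : All (λ x → All (x <_) (left ++ right)) core
    size     : length (left ++ right) ≡ q

min-split : ∀ x xs → AllPairs _≢_ (x ∷ xs) →
  ∃[ L₁ ] ∃[ m ] ∃[ L₂ ] x ∷ xs ≡ L₁ ++ m ∷ L₂ × All (m <_) (L₁ ++ L₂)
min-split x [] _ = [] , x , [] , refl , []
min-split x (y ∷ ys) (x≢ ∷ unique) with min-split y ys unique
... | L₁ , m , L₂ , eq , m< with <-≤-connex x m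
... | inj₁ x<m = [] , x , y ∷ ys , refl ,
  subst (All (x <_)) (sym eq) (All.++⁺ (All.map (<-trans x<m) (All.++⁻ˡ L₁ m<))
    (x<m ∷ All.map (<-trans x<m) (All.++⁻ʳ L₁ m<)))
... | inj₂ m≤x = x ∷ L₁ , m , L₂ , cong (x ∷_) eq , ≤∧≢⇒< m≤x (x≢m ∘ sym) ∷ m<
  where
  x≢m : x ≢ m
  x≢m = All.head (All.++⁻ʳ L₁ (subst (All (x ≢_)) eq x≢))

unique-resp-↭ : ∀ {xs ys : List ℕ} → xs ↭ ys → AllPairs _≢_ xs → AllPairs _≢_ ys
unique-resp-↭ perm = Setoid↭.Unique-resp-↭ (setoid ℕ) (↭⇒↭ₛ perm)

collect : ∀ {O B L : List ℕ} R → O ++ B ↭ L → (O ++ reverse R) ++ B ↭ L ++ R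
collect {O} {B} {L} R perm = begin
  (O ++ reverse R) ++ B  ≡⟨ ++-assoc O (reverse R) B ⟩
  O ++ reverse R ++ B    ↭⟨ ↭-++⁺ˡ O (++-comm (reverse R) B) ⟩
  O ++ B ++ reverse R    ≡⟨ ++-assoc O B (reverse R) ⟨
  (O ++ B) ++ reverse R  ↭⟨ ↭-++⁺ perm (↭-reverse R) ⟩
  L ++ R                 ∎
  where open PermutationReasoning

-- Bookkeeping common to all passes: the smallest outside entry `m` moves into the core, and the
-- other outside entries are merely rearranged.
advance : ∀ {q L R core L′ core′ R′ m π} → AllPairs _≢_ (L ++ R) →
  All (λ x → All (x <_) (L ++ R)) core → length (L ++ R) ≡ suc q →
  L ++ R ↭ m ∷ L′ ++ R′ → All (m <_) (L′ ++ R′) → Sorted R′ →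
  m ∷ core ↭ core′ → Valley core′ → π ≡ L′ ++ core′ ++ R′ → Stage q π
advance unique below size perm m< sortedR′ core↭ valley′ eq = stage eq
  (subst (0 <_) (↭-length core↭) (s≤s z≤n)) valley′ sortedR′
  (AllPairs.tail (unique-resp-↭ perm unique))
  (All-resp-↭ core↭ (m< ∷ All.map (All.tail ∘ All-resp-↭ perm) below))
  (suc-injective (trans (sym (↭-length perm)) size))

stage-first : ∀ {q π} → AllPairs _≢_ π → length π ≡ suc q → Stage q (s132 π)
stage-first {π = x ∷ xs} unique size with min-split x xs unique
... | L₁ , m , L₂ , eq , m< with run-load-min L₁ m L₂ [] m<
... | O , P , B , perm , sorted , _ , runs =
  -- The first pass starts from an empty core, so the whole input can be counted as `R`; the new
  -- core is `m` alone.
  advance {L = []} {R = x ∷ xs} {core = []} {L′ = O ++ P} unique [] size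
    (↭-trans (↭-reflexive eq) (↭-trans (shift m L₁ L₂) (prep m (↭-sym perm))))
    (All-resp-↭ (↭-sym perm) m<) sorted ↭-refl ([] ◂ [])
    (begin
      s132 (x ∷ xs)                         ≡⟨ s132≡run (x ∷ xs) ⟩
      run (x ∷ xs) [] []                    ≡⟨ cong (λ i → run i [] []) (trans eq (sym (++-identityʳ (L₁ ++ m ∷ L₂)))) ⟩
      run ((L₁ ++ m ∷ L₂) ++ []) [] []      ≡⟨ runs ⟩
      run [] (P ++ m ∷ B) O                 ≡⟨ run-end (P ++ m ∷ B) O ⟩
      O ++ P ++ m ∷ B                       ≡⟨ ++-assoc O P (m ∷ B) ⟨
      (O ++ P) ++ m ∷ B                     ∎)
  where open ≡-Reasoning

-- The entry `m` is still on the stack when the core arrives. Whatever lies above it is popped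
-- before `y` is pushed, so `m` ends up right after the reversed core.
min-left : ∀ {q L} L₁ m L₂ y M R → L ≡ L₁ ++ m ∷ L₂ → Valley (y ∷ M) → Sorted R →
  AllPairs _≢_ (L ++ R) →
  All (λ x → All (x <_) (L ++ R)) (y ∷ M) → length (L ++ R) ≡ suc q →
  All (m <_) ((L₁ ++ L₂) ++ R) → Stage q (s132 (L ++ (y ∷ M) ++ R))
min-left L₁ m L₂ y M R refl valley sortedR unique below@(y< ∷ _) size m<
  with run-load-min L₁ m L₂ ((y ∷ M) ++ R) (All.++⁻ˡ (L₁ ++ L₂) m<)
... | O , P , B , perm , sortedB , av , runs
  with run-insert y (M ++ R) P (m ∷ B) O av
         (sorted⇒fits (All.map <⇒≤ (All.++⁻ʳ (O ++ P) (All-resp-↭ (↭-sym perm) (All.++⁻ˡ (L₁ ++ L₂) m<))) ∷ sortedB))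
-- A retained `p` above `m` would give the 132 formed by `y`, `p` and `m`.
... | O′ , p ∷ P′ , refl , av′ , _ = contradiction
  (All.lookup (AllPairs.head (av132-head av′)) (∈-++⁺ʳ P′ (here refl)) y<m) (<⇒≱ m<p)
  where
  m<p : m < p
  m<p = All.head (All.++⁻ʳ O′ (All.++⁻ʳ O (All.++⁻ˡ (O ++ O′ ++ p ∷ P′)
    (All-resp-↭ (↭-sym perm) (All.++⁻ˡ (L₁ ++ L₂) m<)))))
  y<m : y < m
  y<m = All.head (All.++⁻ʳ L₁ (All.++⁻ˡ (L₁ ++ m ∷ L₂) y<))
... | O′ , [] , refl , _ , runs′ =
  advance {L = L} {R = R} {L′ = (O ++ O′) ++ reverse R} unique below size perm″
    (All-resp-↭ (↭-sym perm′) m<) sortedB core↭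
    (All-resp-↭ (↭-sym (↭-reverse (y ∷ M))) (All.map (λ x< → <⇒≤ (All.head (All.++⁻ʳ L₁ (All.++⁻ˡ L x<)))) below)
      ▸ valley-reverse valley)
    output
  where
  L = L₁ ++ m ∷ L₂
  perm′ : ((O ++ O′) ++ reverse R) ++ B ↭ (L₁ ++ L₂) ++ R
  perm′ = collect {O ++ O′} R (subst (λ P → (O ++ P) ++ B ↭ L₁ ++ L₂) (++-identityʳ O′) perm)
  perm″ : L ++ R ↭ m ∷ ((O ++ O′) ++ reverse R) ++ B
  perm″ = ↭-trans (↭-++⁺ʳ R (shift m L₁ L₂)) (prep m (↭-sym perm′))
  core↭ : m ∷ y ∷ M ↭ reverse (y ∷ M) ++ [ m ]
  core↭ = ↭-trans (prep m (↭-sym (↭-reverse (y ∷ M)))) (++-comm [ m ] (reverse (y ∷ M)))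
  m≤B : All (m ≤_) B
  m≤B = All.map <⇒≤ (All.++⁻ʳ ((O ++ O′) ++ reverse R) (All-resp-↭ (↭-sym perm′) m<))
  y∷M≤mB : All (λ x → All (x ≤_) (m ∷ B)) (y ∷ M)
  y∷M≤mB = All.map (λ x< → let x<m = All.head (All.++⁻ʳ L₁ (All.++⁻ˡ L x<)) in
    <⇒≤ x<m ∷ All.map (≤-trans (<⇒≤ x<m)) m≤B) below
  output : s132 (L ++ (y ∷ M) ++ R) ≡ ((O ++ O′) ++ reverse R) ++ (reverse (y ∷ M) ++ [ m ]) ++ B
  output = begin
    s132 (L ++ (y ∷ M) ++ R)           ≡⟨ s132≡run _ ⟩
    run (L ++ (y ∷ M) ++ R) [] []      ≡⟨ runs ⟩
    run (y ∷ M ++ R) ((O′ ++ []) ++ m ∷ B) O   ≡⟨ runs′ ⟩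
    run (M ++ R) (y ∷ m ∷ B) (O ++ O′) ≡⟨ run-finish y M R (m ∷ B) (O ++ O′) valley sortedR (m≤B ∷ sortedB)
                                          (All.map (λ x< → All.map <⇒≤ (All.++⁻ʳ L x<)) below) y∷M≤mB ⟩
    (O ++ O′) ++ reverse R ++ reverse (y ∷ M) ++ m ∷ B          ≡⟨ ++-assoc (O ++ O′) (reverse R) _ ⟨
    ((O ++ O′) ++ reverse R) ++ reverse (y ∷ M) ++ m ∷ B
      ≡⟨ cong (((O ++ O′) ++ reverse R) ++_) (++-assoc (reverse (y ∷ M)) [ m ] B) ⟨
    ((O ++ O′) ++ reverse R) ++ (reverse (y ∷ M) ++ [ m ]) ++ B ∎
    where open ≡-Reasoning

-- The right part is output in reverse, so its smallest entry `r` comes last there, right before the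
-- reversed core.
min-right : ∀ {q} L y M r R → Valley (y ∷ M) → Sorted (r ∷ R) → AllPairs _≢_ (L ++ r ∷ R) →
  All (λ x → All (x <_) (L ++ r ∷ R)) (y ∷ M) → length (L ++ r ∷ R) ≡ suc q →
  All (r <_) (L ++ R) → Stage q (s132 (L ++ (y ∷ M) ++ r ∷ R))
min-right L y M r R valley sortedR unique below@(y< ∷ _) size r<
  with run-load L ((y ∷ M) ++ r ∷ R) [] [] [] (λ ()) (All.universal (λ _ → []) L)
... | O , P , perm , av , runs
  with run-insert y (M ++ r ∷ R) P [] O av []
... | O′ , B , refl , av′ , runs′ =
  advance {L = L} {R = r ∷ R} {L′ = (O ++ O′) ++ reverse R} unique below size
    (↭-trans (shift r L R) (prep r (↭-sym perm′)))
    (All-resp-↭ (↭-sym perm′) r<) sortedB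
    (prep r (↭-sym (↭-reverse (y ∷ M))))
    (All-resp-↭ (↭-sym (↭-reverse (y ∷ M))) (All.map (λ x< → <⇒≤ (All.head (All.++⁻ʳ L x<))) below)
      ◂ valley-reverse valley)
    output
  where
  stack : O ++ O′ ++ B ↭ L
  stack = ↭-trans perm (↭-reflexive (++-identityʳ L))
  perm′ : ((O ++ O′) ++ reverse R) ++ B ↭ L ++ R
  perm′ = collect {O ++ O′} R (↭-trans (↭-reflexive (++-assoc O O′ B)) stack)
  <B : ∀ {x} → All (x <_) L → All (x <_) B
  <B x< = All.++⁻ʳ O′ (All.++⁻ʳ O (All-resp-↭ (↭-sym stack) x<))
  sortedB : Sorted B
  sortedB = fits⇒sorted (<B (All.++⁻ˡ L y<)) (subst (Fits y) (++-identityʳ B) (av132-head av′))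
  output : s132 (L ++ (y ∷ M) ++ r ∷ R) ≡ ((O ++ O′) ++ reverse R) ++ (r ∷ reverse (y ∷ M)) ++ B
  output = begin
    s132 (L ++ (y ∷ M) ++ r ∷ R)              ≡⟨ s132≡run _ ⟩
    run (L ++ (y ∷ M) ++ r ∷ R) [] []         ≡⟨ runs ⟩
    run (y ∷ M ++ r ∷ R) ((O′ ++ B) ++ []) O  ≡⟨ runs′ ⟩
    run (M ++ r ∷ R) (y ∷ B ++ []) (O ++ O′)  ≡⟨ cong (λ st → run (M ++ r ∷ R) (y ∷ st) (O ++ O′)) (++-identityʳ B) ⟩
    run (M ++ r ∷ R) (y ∷ B) (O ++ O′)        ≡⟨ run-finish y M (r ∷ R) B (O ++ O′) valley sortedR sortedB
      (All.map (λ x< → All.map <⇒≤ (All.++⁻ʳ L x<)) below)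
      (All.map (λ x< → All.map <⇒≤ (<B (All.++⁻ˡ L x<))) below) ⟩
    (O ++ O′) ++ reverse (r ∷ R) ++ reverse (y ∷ M) ++ B        ≡⟨ ++-assoc (O ++ O′) (reverse (r ∷ R)) _ ⟨
    ((O ++ O′) ++ reverse (r ∷ R)) ++ reverse (y ∷ M) ++ B
      ≡⟨ cong (λ xs → ((O ++ O′) ++ xs) ++ reverse (y ∷ M) ++ B) (unfold-reverse r R) ⟩
    ((O ++ O′) ++ reverse R ++ [ r ]) ++ reverse (y ∷ M) ++ B
      ≡⟨ cong (_++ (reverse (y ∷ M) ++ B)) (++-assoc (O ++ O′) (reverse R) [ r ]) ⟨
    (((O ++ O′) ++ reverse R) ++ [ r ]) ++ reverse (y ∷ M) ++ B ≡⟨ ++-assoc ((O ++ O′) ++ reverse R) [ r ] _ ⟩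
    ((O ++ O′) ++ reverse R) ++ (r ∷ reverse (y ∷ M)) ++ B      ∎
    where open ≡-Reasoning

unique-++⁻ : ∀ (xs : List ℕ) {ys} → AllPairs _≢_ (xs ++ ys) →
  AllPairs _≢_ xs × AllPairs _≢_ ys
unique-++⁻ [] u = [] , u
unique-++⁻ (x ∷ xs) (x≢ ∷ u) with unique-++⁻ xs u
... | uˣ , uʸ = All.++⁻ˡ xs x≢ ∷ uˣ , uʸ

sorted-head-< : ∀ {r R} → Sorted (r ∷ R) → AllPairs _≢_ (r ∷ R) → All (r <_) R
sorted-head-< (r≤R ∷ _) (r≢R ∷ _) = All.zipWith (λ (r≤x , r≢x) → ≤∧≢⇒< r≤x r≢x) (r≤R , r≢R)

-- The smallest outside entry is the minimum of `left` or the head of the increasing `right`.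
stage-step : ∀ {q π} → Stage (suc q) π → Stage q (s132 π)
stage-step (stage {[]} {y ∷ M} {r ∷ R} refl _ v sorted unique below size) =
  min-right [] y M r R v sorted unique below size (sorted-head-< sorted unique)
stage-step (stage {x ∷ xs} {y ∷ M} {[]} refl _ v sorted unique below size)
  with min-split x xs (proj₁ (unique-++⁻ (x ∷ xs) unique))
... | L₁ , m , L₂ , eq , m< =
  min-left L₁ m L₂ y M [] eq v sorted unique below size (All.++⁺ m< [])
stage-step (stage {x ∷ xs} {y ∷ M} {r ∷ R} refl _ v sorted unique below size)
  with min-split x xs (proj₁ (unique-++⁻ (x ∷ xs) unique))
... | L₁ , m , L₂ , eq , m< with sorted-head-< sorted (proj₂ (unique-++⁻ (x ∷ xs) unique)) | <-cmp m r
... | r<R | tri< m<r _ _ =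
  min-left L₁ m L₂ y M (r ∷ R) eq v sorted unique below size
    (All.++⁺ m< (m<r ∷ All.map (<-trans m<r) r<R))
... | r<R | tri> _ _ r<m =
  min-right (x ∷ xs) y M r R v sorted unique below size
    (All.++⁺ (subst (All (r <_)) (sym eq)
      (All.++⁺ (All.map (<-trans r<m) (All.++⁻ˡ L₁ m<)) (r<m ∷ All.map (<-trans r<m) (All.++⁻ʳ L₁ m<)))) r<R)
... | _ | tri≈ _ m≡r _ = contradiction m≡r
  (All.head (All.++⁻ʳ L₂ (AllPairs.head (proj₂ (unique-++⁻ L₁ split)))))
  where
  split : AllPairs _≢_ (L₁ ++ m ∷ L₂ ++ r ∷ R)
  split = subst (AllPairs _≢_) (trans (cong (_++ (r ∷ R)) eq) (++-assoc L₁ (m ∷ L₂) (r ∷ R))) unique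

-- The last outside entry exceeds the core and stands at one of its ends, so the whole list is a
-- valley.
stage-avoidsBoth : ∀ {π} → Stage 1 π → AvoidsBoth π
stage-avoidsBoth (stage {[]} {C} {r ∷ []} refl _ v _ _ below _) =
  valley⇒avoidsBoth (All.map (<⇒≤ ∘ All.head) below ▸ v)
stage-avoidsBoth (stage {l ∷ []} {C} {[]} refl _ v _ _ below _) =
  subst AvoidsBoth (sym (cong (l ∷_) (++-identityʳ C)))
    (valley⇒avoidsBoth (All.map (<⇒≤ ∘ All.head) below ◂ v))

stage-iter : ∀ {q π} i → AllPairs _≢_ π → length π ≡ suc i + q → Stage q (iter (suc i) s132 π)
stage-iter zero unique size = stage-first unique size
stage-iter (suc i) unique size = stage-step (stage-iter i unique (trans size (cong suc (sym (+-suc i _)))))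

-- Each of the `1 + n` passes absorbs one of the `2 + n` entries, which leaves a single one outside
-- the core.
avoidsBoth-iter : ∀ {n π} → IsPerm (2 + n) π → AvoidsBoth (iter (1 + n) s132 π)
avoidsBoth-iter {n} {π} perm = stage-avoidsBoth (stage-iter n unique
  (trans (↭-length perm) (trans (length-map suc (upTo (2 + n)))
    (trans (length-upTo (2 + n)) (cong suc (sym (+-comm n 1)))))))
  where
  unique : AllPairs _≢_ π
  unique = unique-resp-↭ (↭-sym perm) (AllPairs.map⁺
    (AllPairs.applyUpTo⁺₁ (λ i → i) (2 + n) (λ i<j _ eq → <⇒≢ i<j (suc-injective eq))))

-- The least number of passes

avoidsBoth? : ∀ π → Dec (AvoidsBoth π)
avoidsBoth? π = (contains p132 π Bool.≟ false) ×-dec (contains p231 π Bool.≟ false)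

least : ∀ {P : ℕ → Set} → (∀ t → Dec (P t)) → ∀ t → P t →
  ∃[ m ] (m ≤ t × P m × ∀ u → u < m → ¬ P u)
least P? zero p = 0 , z≤n , p , λ _ ()
least P? (suc t) p with P? 0
... | yes p₀ = 0 , z≤n , p₀ , λ _ ()
... | no ¬p₀ with least (P? ∘ suc) t p
... | m , m≤t , pₘ , below = suc m , s≤s m≤t , pₘ , λ where
  zero _ → ¬p₀
  (suc u) (s≤s u<m) → below u u<m

-- A permutation that attains the bound

ap : ℕ → ℕ → ℕ
ap a i = a + i * 3

asc desc : ℕ → ℕ → List ℕ
asc a = applyUpTo (ap a)
desc a = applyDownFrom (ap a)

ap-suc : ∀ a i → ap a (suc i) ≡ 3 + ap a i
ap-suc a i = trans (sym (+-assoc a 3 (i * 3))) (cong (_+ i * 3) (+-comm a 3))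

asc-∷ : ∀ a c → asc a (suc c) ≡ a ∷ asc (3 + a) c
asc-∷ a c = cong₂ _∷_ (+-identityʳ a)
  (trans (sym (map-upTo (ap a ∘ suc) c)) (trans (map-cong (ap-suc a) (upTo c)) (map-upTo (ap (3 + a)) c)))

desc-∷ʳ : ∀ a c → desc (3 + a) c ++ [ a ] ≡ desc a (suc c)
desc-∷ʳ a c = begin
  desc (3 + a) c ++ [ a ]             ≡⟨ cong (_++ [ a ]) (reverse-applyUpTo (ap (3 + a)) c) ⟨
  reverse (asc (3 + a) c) ++ [ a ]    ≡⟨ unfold-reverse a (asc (3 + a) c) ⟨
  reverse (a ∷ asc (3 + a) c)         ≡⟨ cong reverse (asc-∷ a c) ⟨
  reverse (asc a (suc c))             ≡⟨ reverse-applyUpTo (ap a) (suc c) ⟩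
  desc a (suc c)                      ∎
  where open ≡-Reasoning

asc-sorted : ∀ a c → Sorted (asc a c)
asc-sorted a c = AllPairs.applyUpTo⁺₁ (ap a) c (λ i<j _ → +-monoʳ-≤ a (*-monoˡ-≤ 3 (<⇒≤ i<j)))

asc-≥ : ∀ {x} a c → x ≤ a → All (x ≤_) (asc a c)
asc-≥ a c x≤a = All.applyUpTo⁺₂ (ap a) c (λ i → ≤-trans x≤a (m≤m+n a (i * 3)))

asc-++-∷ : ∀ a c xs → asc a c ++ ap a c ∷ xs ≡ asc a (suc c) ++ xs
asc-++-∷ a c xs = trans (sym (∷ʳ-++ (asc a c) (ap a c) xs)) (cong (_++ xs) (applyUpTo-∷ʳ (ap a) c))

run-push-sorted : ∀ {x inp st out} → Sorted st → run (x ∷ inp) st out ≡ run inp (x ∷ st) out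
run-push-sorted sorted = run-push (av132-∷ (sorted⇒fits sorted) (sorted⇒av132 sorted))

-- Pushing `z` would create the 132 `z`, `x`, `u`. The input is given through an equation because
-- its first entry may be hidden in a concatenation.
run-pop-above : ∀ {z u x inp inp′ st out} → inp ≡ z ∷ inp′ → z < u → u ∈ st → u < x →
  run inp (x ∷ st) out ≡ run inp st (out ++ [ x ])
run-pop-above refl z<u u∈st u<x =
  run-pop λ av → <⇒≱ u<x (av (refl ∷ refl ∷ from∈ u∈st) z<u)

-- Every entry is popped by its successor, since U has an entry strictly between the two.
run-zigzag : ∀ a c {U y inp} out → Sorted U → (∀ {i} → i < c → ap a i ∈ U) → y < a →
  run (desc (suc a) c ++ y ∷ inp) U out ≡ run (y ∷ inp) U (out ++ desc (suc a) c)
run-zigzag a zero out _ _ _ = cong (run _ _) (sym (++-identityʳ out))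
run-zigzag a (suc c) {U} {y} {inp} out sorted ∈U y<a with next c
  where
  next : ∀ c → ∃[ z ] ∃[ inp′ ] desc (suc a) c ++ y ∷ inp ≡ z ∷ inp′ × z < ap a c
  next zero = y , inp , refl , ≤-trans y<a (m≤m+n a 0)
  next (suc c) = ap (suc a) c , _ , refl , ≤-trans (n≤1+n _) (≤-reflexive (sym (ap-suc a c)))
... | z , inp′ , eq , z< = begin
  run (d ∷ rest) U out                            ≡⟨ run-push-sorted sorted ⟩
  run rest (d ∷ U) out                            ≡⟨ run-pop-above eq z< (∈U ≤-refl) ≤-refl ⟩
  run rest U (out ++ [ d ])                       ≡⟨ run-zigzag a c (out ++ [ d ]) sorted (∈U ∘ m<n⇒m<1+n) y<a ⟩
  run (y ∷ inp) U ((out ++ [ d ]) ++ desc (suc a) c) ≡⟨ cong (run _ U) (++-assoc out [ d ] _) ⟩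
  run (y ∷ inp) U (out ++ desc (suc a) (suc c))   ∎
  where
  open ≡-Reasoning
  d = ap (suc a) c
  rest = desc (suc a) c ++ y ∷ inp

-- The numbers `c₁`, `c₂`, `c₃` count the entries of `k + 1, ..., k + m` congruent to `k + 1`,
-- `k + 2` and `k` mod 3; the inequalities express the balance of these counts for consecutive
-- integers.
record Spiral (k m : ℕ) (π : List ℕ) : Set where
  constructor spiral
  field
    c₁ c₂ c₃ : ℕ
    core     : List ℕ
    split    : π ≡ desc (1 + k) c₁ ++ desc (2 + k) c₂ ++ core ++ asc (3 + k) c₃
    nonempty : 0 < length core
    valley   : Valley core
    core≤k   : All (_≤ k) core
    c₂≤c₁    : c₂ ≤ c₁
    c₃≤c₂    : c₃ ≤ c₂
    c₁≤1+c₃  : c₁ ≤ suc c₃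
    size     : c₁ + (c₂ + c₃) ≡ m

-- The first block stays on the stack as `U`; the second is popped and becomes the first; the right
-- part, reversed, becomes the second. The head of `U` joins the core and its tail is the new right
-- part. The counts rotate to `c₂`, `c₃`, `c₁ - 1`.
spiral-step : ∀ {k m π} → Spiral k (suc m) π → Spiral (suc k) m (s132 π)
spiral-step (spiral zero zero zero _ _ _ _ _ _ _ _ ())
spiral-step {k} {m} (spiral (suc c) c₂ c₃ (y ∷ M) refl _ valley core≤k c₂≤c₁ c₃≤c₂ (s≤s c≤c₃) size) =
  spiral c₂ c₃ c (reverse (y ∷ M) ++ [ suc k ]) output
    (subst (0 <_) (↭-length (++-comm [ suc k ] (reverse (y ∷ M)))) (s≤s z≤n))
    (All.map m≤n⇒m≤1+n core≤k′ ▸ valley-reverse valley)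
    (All.++⁺ (All.map m≤n⇒m≤1+n core≤k′) (≤-refl ∷ []))
    c₃≤c₂ c≤c₃ c₂≤c₁
    (trans (sym (+-assoc c₂ c₃ c)) (trans (+-comm (c₂ + c₃) c) (suc-injective size)))
  where
  U = asc (suc k) (suc c)
  D = desc (2 + k) c₂
  R = asc (3 + k) c₃
  core≤k′ = All-resp-↭ (↭-sym (↭-reverse (y ∷ M))) core≤k
  core≤asc : ∀ j c → k ≤ j → All (λ x → All (x ≤_) (asc j c)) (y ∷ M)
  core≤asc j c k≤j = All.map (λ x≤k → asc-≥ j c (≤-trans x≤k k≤j)) core≤k
  output : s132 (desc (1 + k) (suc c) ++ D ++ (y ∷ M) ++ R) ≡
    D ++ desc (3 + k) c₃ ++ (reverse (y ∷ M) ++ [ suc k ]) ++ asc (4 + k) c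
  output = begin
    s132 (desc (1 + k) (suc c) ++ D ++ (y ∷ M) ++ R)
      ≡⟨ s132≡run _ ⟩
    run (desc (1 + k) (suc c) ++ D ++ (y ∷ M) ++ R) [] []
      ≡⟨ run-pushAll (desc (1 + k) (suc c)) (subst Av132 (sym loaded) (sorted⇒av132 (asc-sorted (suc k) (suc c)))) ⟩
    run (D ++ (y ∷ M) ++ R) (reverse (desc (1 + k) (suc c))) []
      ≡⟨ cong (λ st → run (D ++ (y ∷ M) ++ R) st []) loaded ⟩
    run (D ++ (y ∷ M) ++ R) U []
      -- Since `c₂ ≤ c₁`, the stack `U` holds the predecessor of each entry of `D`.
      ≡⟨ run-zigzag (suc k) c₂ [] (asc-sorted (suc k) (suc c))
           (λ i<c₂ → ∈-applyUpTo⁺ (ap (suc k)) (≤-trans i<c₂ c₂≤c₁)) (s≤s (All.head core≤k)) ⟩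
    run ((y ∷ M) ++ R) U D
      ≡⟨ run-push-sorted (asc-sorted (suc k) (suc c)) ⟩
    run (M ++ R) (y ∷ U) D
      ≡⟨ run-finish y M R U D valley (asc-sorted (3 + k) c₃) (asc-sorted (suc k) (suc c))
           (core≤asc (3 + k) c₃ (m≤n+m k 3)) (core≤asc (suc k) (suc c) (n≤1+n k)) ⟩
    D ++ reverse R ++ reverse (y ∷ M) ++ U
      ≡⟨ cong₂ (λ R U → D ++ R ++ reverse (y ∷ M) ++ U) (reverse-applyUpTo (ap (3 + k)) c₃) (asc-∷ (suc k) c) ⟩
    D ++ desc (3 + k) c₃ ++ reverse (y ∷ M) ++ suc k ∷ asc (4 + k) c
      ≡⟨ cong (λ xs → D ++ desc (3 + k) c₃ ++ xs) (++-assoc (reverse (y ∷ M)) [ suc k ] _) ⟨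
    D ++ desc (3 + k) c₃ ++ (reverse (y ∷ M) ++ [ suc k ]) ++ asc (4 + k) c ∎
    where
    open ≡-Reasoning
    loaded : reverse (desc (1 + k) (suc c)) ≡ U
    loaded = reverse-applyDownFrom (ap (suc k)) (suc c)

-- Two outside entries force `c₁` and `c₂` to be positive: `c₂ = 0` gives `c₃ = 0`, hence `c₁ ≤ 1`.
spiral-¬avoidsBoth : ∀ {k m π} → Spiral k (2 + m) π → ¬ AvoidsBoth π
spiral-¬avoidsBoth (spiral (suc zero) zero zero _ _ _ _ _ _ _ _ ())
spiral-¬avoidsBoth (spiral (suc (suc _)) zero zero _ _ _ _ _ _ _ (s≤s ()) _)
spiral-¬avoidsBoth {k} (spiral (suc c₁) (suc c₂) c₃ (y ∷ M) refl _ _ (y≤k ∷ _) _ _ _ _) (_ , avoids) =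
  1+n≰n (avoids⇒av231 avoids (++⁺ (from∈ (last∈ (suc k) c₁))
    (++⁺ (from∈ (last∈ (2 + k) c₂)) (++⁺ʳ _ (refl ∷ minimum M)))) (s≤s y≤k))
  where
  last∈ : ∀ a c → a ∈ desc a (suc c)
  last∈ a c = subst (_∈ desc a (suc c)) (+-identityʳ a) (∈-applyDownFrom⁺ (ap a) (s≤s z≤n))


-- The first two passes from the starting permutation

data Residue : Set where
  r0 r1 r2 : Residue

value : Residue → ℕ
value r0 = 0
value r1 = 1
value r2 = 2

-- For `n = 3 + value r + 3 * c`, the numbers of terms up to `n` in the progressions 4, 7, ... and
-- 5, 8, ...; the progression 3, 6, ... has `suc c`.
count₂ count₃ : Residue → ℕ → ℕ
count₂ r0 c = c
count₂ r1 c = suc c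
count₂ r2 c = suc c
count₃ r0 c = c
count₃ r1 c = c
count₃ r2 c = suc c

triples pairs : ℕ → List ℕ
triples zero = []
triples (suc c) = ap 4 c ∷ ap 6 c ∷ ap 5 c ∷ triples c
pairs zero = []
pairs (suc c) = ap 5 c ∷ ap 6 c ∷ pairs c

above₀ above₁ : Residue → ℕ → List ℕ
above₀ r0 c = []
above₀ r1 c = ap 4 c ∷ []
above₀ r2 c = ap 4 c ∷ ap 5 c ∷ []
above₁ r0 c = []
above₁ r1 c = []
above₁ r2 c = ap 5 c ∷ []

-- The first three iterates; e.g. r2 and c = 2 give
--   10 11 7 9 8 4 6 5 1 3 2,   11 8 9 5 6 2 3 1 4 7 10   and   9 6 3 10 7 4 1 2 5 8 11.
state₀ state₁ state₂ : Residue → ℕ → List ℕ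
state₀ r c = above₀ r c ++ triples c ++ 1 ∷ 3 ∷ 2 ∷ []
state₁ r c = above₁ r c ++ pairs c ++ 2 ∷ 3 ∷ 1 ∷ asc 4 (count₂ r c)
state₂ r c = desc 3 (suc c) ++ desc 4 (count₂ r c) ++ (1 ∷ 2 ∷ []) ++ asc 5 (count₃ r c)

run-push-triple : ∀ b {inp U out} → Sorted (b ∷ U) →
  run (b ∷ 2 + b ∷ 1 + b ∷ inp) U out ≡ run inp (1 + b ∷ 2 + b ∷ b ∷ U) out
run-push-triple b {U = U} sorted@(b≤U ∷ sortedU) =
  trans (run-push-sorted sortedU) (trans (run-push-sorted sorted)
    (run-push (av132-∷ (fits ∷ sorted⇒fits sorted) (av132-∷ (sorted⇒fits sorted) (sorted⇒av132 sorted)))))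
  where
  fits : All (λ c → 1 + b < c → 2 + b ≤ c) (b ∷ U)
  -- No integer lies strictly between `1 + b` and `2 + b`: the premise is the conclusion by
  -- definition.
  fits = All.universal (λ _ → id) _

next-triple : ∀ c rest → ∃[ z ] ∃[ inp ] triples c ++ 1 ∷ rest ≡ z ∷ inp × z < ap 4 c
next-triple zero rest = 1 , rest , refl , s≤s (s≤s z≤n)
next-triple (suc c) rest = ap 4 c , _ , refl ,
  s≤s (≤-trans (m≤n+m (ap 4 c) 2) (≤-reflexive (sym (cong (_∸ 1) (ap-suc 4 c)))))

-- The entry after a triple is below its smallest entry `b`, so it pops `1 + b` and `2 + b`, which
-- lie above `b` on the stack; `b` itself stays.
run-triples : ∀ c rest {U} out → Sorted U → All (ap 4 c ≤_) U →
  run (triples c ++ 1 ∷ rest) U out ≡ run (1 ∷ rest) (asc 4 c ++ U) (out ++ pairs c)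
run-triples zero rest out _ _ = cong (run _ _) (sym (++-identityʳ out))
run-triples (suc c) rest {U} out sorted ≤U with next-triple c rest
... | z , inp , eq , z<b = begin
  run (b ∷ 2 + b ∷ 1 + b ∷ more) U out            ≡⟨ run-push-triple b sorted′ ⟩
  run more (1 + b ∷ 2 + b ∷ b ∷ U) out            ≡⟨ run-pop-above eq z<b (there (here refl)) ≤-refl ⟩
  run more (2 + b ∷ b ∷ U) (out ++ [ 1 + b ])     ≡⟨ run-pop-above eq z<b (here refl) (n≤1+n _) ⟩
  run more (b ∷ U) ((out ++ [ 1 + b ]) ++ [ 2 + b ])
    ≡⟨ run-triples c rest _ sorted′ (≤-refl ∷ b≤U) ⟩
  run (1 ∷ rest) (asc 4 c ++ b ∷ U) (((out ++ [ 1 + b ]) ++ [ 2 + b ]) ++ pairs c)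
    ≡⟨ cong₂ (run (1 ∷ rest)) (asc-++-∷ 4 c U) (trans (++-assoc (out ++ [ 1 + b ]) _ _) (++-assoc out _ _)) ⟩
  run (1 ∷ rest) (asc 4 (suc c) ++ U) (out ++ pairs (suc c)) ∎
  where
  open ≡-Reasoning
  b = ap 4 c
  more = triples c ++ 1 ∷ rest
  b≤U : All (b ≤_) U
  b≤U = All.map (≤-trans (≤-trans (m≤n+m b 3) (≤-reflexive (sym (ap-suc 4 c))))) ≤U
  sorted′ = b≤U ∷ sorted

-- No input follows the final 1, 3, 2, so it leaves the stack as 2, 3, 1.
run-triples-end : ∀ c {U} out → Sorted U → All (ap 4 c ≤_) U →
  run (triples c ++ 1 ∷ 3 ∷ 2 ∷ []) U out ≡ out ++ pairs c ++ 2 ∷ 3 ∷ 1 ∷ asc 4 c ++ U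
run-triples-end c {U} out sorted ≤U = begin
  run (triples c ++ 1 ∷ 3 ∷ 2 ∷ []) U out               ≡⟨ run-triples c (3 ∷ 2 ∷ []) out sorted ≤U ⟩
  run (1 ∷ 3 ∷ 2 ∷ []) (asc 4 c ++ U) (out ++ pairs c)  ≡⟨ run-push-triple 1 (1≤ ∷ sorted′) ⟩
  run [] (2 ∷ 3 ∷ 1 ∷ asc 4 c ++ U) (out ++ pairs c)    ≡⟨ run-end _ (out ++ pairs c) ⟩
  (out ++ pairs c) ++ 2 ∷ 3 ∷ 1 ∷ asc 4 c ++ U          ≡⟨ ++-assoc out (pairs c) _ ⟩
  out ++ pairs c ++ 2 ∷ 3 ∷ 1 ∷ asc 4 c ++ U            ∎
  where
  open ≡-Reasoning
  sorted′ : Sorted (asc 4 c ++ U)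
  sorted′ = AllPairs.++⁺ (asc-sorted 4 c) sorted
    (All.applyUpTo⁺₁ (ap 4) c λ i<c → All.map (≤-trans (+-monoʳ-≤ 4 (*-monoˡ-≤ 3 (<⇒≤ i<c)))) ≤U)
  1≤ : All (1 ≤_) (asc 4 c ++ U)
  1≤ = All.++⁺ (asc-≥ 4 c (s≤s z≤n)) (All.map (≤-trans (s≤s z≤n)) ≤U)

s132-state₀ : ∀ r c → s132 (state₀ r c) ≡ state₁ r c
s132-state₀ r0 c = trans (s132≡run _) (trans (run-triples-end c [] [] [])
  (cong (λ U → pairs c ++ 2 ∷ 3 ∷ 1 ∷ U) (++-identityʳ (asc 4 c))))
s132-state₀ r1 c = trans (s132≡run _) (trans (run-push-sorted [])
  (trans (run-triples-end c [] ([] ∷ []) (≤-refl ∷ []))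
  (cong (λ U → pairs c ++ 2 ∷ 3 ∷ 1 ∷ U) (applyUpTo-∷ʳ (ap 4) c))))
s132-state₀ r2 c with next-triple c (3 ∷ 2 ∷ [])
... | z , inp , eq , z<b = trans (s132≡run _) (trans (run-push-sorted [])
  (trans (run-push-sorted ([] ∷ []))
  (trans (run-pop-above eq z<b (here refl) ≤-refl)
  (trans (run-triples-end c (ap 5 c ∷ []) ([] ∷ []) (≤-refl ∷ []))
  (cong (λ U → ap 5 c ∷ pairs c ++ 2 ∷ 3 ∷ 1 ∷ U) (applyUpTo-∷ʳ (ap 4) c))))))

next-pair : ∀ c rest → ∃[ z ] ∃[ inp ] pairs c ++ 2 ∷ rest ≡ z ∷ inp × z < ap 5 c
next-pair zero rest = 2 , rest , refl , s≤s (s≤s (s≤s z≤n))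
next-pair (suc c) rest = ap 5 c , _ , refl , ≤-trans (m≤n+m (suc (ap 5 c)) 2) (≤-reflexive (sym (ap-suc 5 c)))

-- Of each pair `b`, `1 + b` only the upper entry is popped, since the next input entry is below
-- `b`.
run-pairs : ∀ c rest {U} out → Sorted U → All (ap 5 c ≤_) U →
  run (pairs c ++ 2 ∷ rest) U out ≡ run (2 ∷ rest) (asc 5 c ++ U) (out ++ desc 6 c)
run-pairs zero rest out _ _ = cong (run _ _) (sym (++-identityʳ out))
run-pairs (suc c) rest {U} out sorted ≤U with next-pair c rest
... | z , inp , eq , z<b = begin
  run (b ∷ 1 + b ∷ more) U out           ≡⟨ run-push-sorted sorted ⟩
  run (1 + b ∷ more) (b ∷ U) out         ≡⟨ run-push-sorted sorted′ ⟩
  run more (1 + b ∷ b ∷ U) out           ≡⟨ run-pop-above eq z<b (here refl) ≤-refl ⟩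
  run more (b ∷ U) (out ++ [ 1 + b ])    ≡⟨ run-pairs c rest _ sorted′ (≤-refl ∷ b≤U) ⟩
  run (2 ∷ rest) (asc 5 c ++ b ∷ U) ((out ++ [ 1 + b ]) ++ desc 6 c)
    ≡⟨ cong₂ (run (2 ∷ rest)) (asc-++-∷ 5 c U) (++-assoc out _ _) ⟩
  run (2 ∷ rest) (asc 5 (suc c) ++ U) (out ++ desc 6 (suc c)) ∎
  where
  open ≡-Reasoning
  b = ap 5 c
  more = pairs c ++ 2 ∷ rest
  b≤U : All (b ≤_) U
  b≤U = All.map (≤-trans (≤-trans (m≤n+m b 3) (≤-reflexive (sym (ap-suc 5 c))))) ≤U
  sorted′ = b≤U ∷ sorted

-- The 1 pops the 3 because of the 2 below it; then 1, 2 stays together and serves as the first core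
-- of the spiral.
run-pairs-end : ∀ c c₂ {U} → Sorted U → All (ap 5 c ≤_) U →
  run (pairs c ++ 2 ∷ 3 ∷ 1 ∷ asc 4 c₂) U [] ≡
    desc 3 (suc c) ++ desc 4 c₂ ++ (1 ∷ 2 ∷ []) ++ asc 5 c ++ U
run-pairs-end c c₂ {U} sorted ≤U = begin
  run (pairs c ++ 2 ∷ 3 ∷ 1 ∷ R) U []             ≡⟨ run-pairs c (3 ∷ 1 ∷ R) [] sorted ≤U ⟩
  run (2 ∷ 3 ∷ 1 ∷ R) B (desc 6 c)                ≡⟨ run-push-sorted sortedB ⟩
  run (3 ∷ 1 ∷ R) (2 ∷ B) (desc 6 c)              ≡⟨ run-push-sorted sorted2B ⟩
  run (1 ∷ R) (3 ∷ 2 ∷ B) (desc 6 c)              ≡⟨ run-pop-above refl (s≤s (s≤s z≤n)) (here refl) ≤-refl ⟩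
  run (1 ∷ R) (2 ∷ B) (desc 6 c ++ [ 3 ])         ≡⟨ run-push-sorted sorted2B ⟩
  run R (1 ∷ 2 ∷ B) (desc 6 c ++ [ 3 ])           ≡⟨ run-finish 1 [] R (2 ∷ B) _ ([] ◂ []) (asc-sorted 4 c₂) sorted2B
    (asc-≥ 4 c₂ (s≤s z≤n) ∷ []) ((s≤s z≤n ∷ All.map (≤-trans (s≤s z≤n)) 2≤B) ∷ []) ⟩
  (desc 6 c ++ [ 3 ]) ++ reverse R ++ 1 ∷ 2 ∷ B   ≡⟨ cong₂ (λ D R → D ++ R ++ 1 ∷ 2 ∷ B) (desc-∷ʳ 3 c) (reverse-applyUpTo (ap 4) c₂) ⟩
  desc 3 (suc c) ++ desc 4 c₂ ++ 1 ∷ 2 ∷ B        ∎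
  where
  open ≡-Reasoning
  R = asc 4 c₂
  B = asc 5 c ++ U
  sortedB : Sorted B
  sortedB = AllPairs.++⁺ (asc-sorted 5 c) sorted
    (All.applyUpTo⁺₁ (ap 5) c λ i<c → All.map (≤-trans (+-monoʳ-≤ 5 (*-monoˡ-≤ 3 (<⇒≤ i<c)))) ≤U)
  2≤B : All (2 ≤_) B
  2≤B = All.++⁺ (asc-≥ 5 c (s≤s (s≤s z≤n))) (All.map (≤-trans (s≤s (s≤s z≤n))) ≤U)
  sorted2B = 2≤B ∷ sortedB

s132-state₁ : ∀ r c → s132 (state₁ r c) ≡ state₂ r c
s132-state₁ r0 c = trans (s132≡run _) (trans (run-pairs-end c c [] [])
  (cong (λ U → desc 3 (suc c) ++ desc 4 c ++ 1 ∷ 2 ∷ U) (++-identityʳ (asc 5 c))))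
s132-state₁ r1 c = trans (s132≡run _) (trans (run-pairs-end c (suc c) [] [])
  (cong (λ U → desc 3 (suc c) ++ desc 4 (suc c) ++ 1 ∷ 2 ∷ U) (++-identityʳ (asc 5 c))))
s132-state₁ r2 c = trans (s132≡run _) (trans (run-push-sorted [])
  (trans (run-pairs-end c (suc c) ([] ∷ []) (≤-refl ∷ []))
  (cong (λ U → desc 3 (suc c) ++ desc 4 (suc c) ++ 1 ∷ 2 ∷ U) (applyUpTo-∷ʳ (ap 5) c))))

count-total : ∀ r c → suc c + (count₂ r c + count₃ r c) ≡ suc (value r + c * 3)
count-total r0 = total₀
  where
  total₀ : ∀ c → suc c + (c + c) ≡ suc (c * 3)
  total₀ = solve-∀
count-total r1 = total₁
  where
  total₁ : ∀ c → suc c + (suc c + c) ≡ suc (1 + c * 3)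
  total₁ = solve-∀
count-total r2 = total₂
  where
  total₂ : ∀ c → suc c + (suc c + suc c) ≡ suc (2 + c * 3)
  total₂ = solve-∀

spiral-state₂ : ∀ r c → Spiral 2 (suc (value r + c * 3)) (state₂ r c)
spiral-state₂ r c = spiral (suc c) (count₂ r c) (count₃ r c) (1 ∷ 2 ∷ []) refl (s≤s z≤n)
  ((s≤s z≤n ∷ []) ▸ ([] ◂ [])) (s≤s z≤n ∷ ≤-refl ∷ [])
  (c₂≤ r) (c₃≤ r) (c₁≤ r) (count-total r c)
  where
  c₂≤ : ∀ r → count₂ r c ≤ suc c
  c₂≤ r0 = n≤1+n c
  c₂≤ r1 = ≤-refl
  c₂≤ r2 = ≤-refl
  c₃≤ : ∀ r → count₃ r c ≤ count₂ r c
  c₃≤ r0 = ≤-refl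
  c₃≤ r1 = n≤1+n c
  c₃≤ r2 = ≤-refl
  c₁≤ : ∀ r → suc c ≤ suc (count₃ r c)
  c₁≤ r0 = ≤-refl
  c₁≤ r1 = ≤-refl
  c₁≤ r2 = n≤1+n (suc c)

-- The hypothesis says `m + i = n - 2`: after two passes `n - 2` entries are outside the core, and
-- each later pass absorbs one.
spiral-iter : ∀ r c i m → m + i ≡ suc (value r + c * 3) →
  Spiral (2 + i) m (iter (2 + i) s132 (state₀ r c))
spiral-iter r c zero m eq = subst (Spiral 2 m)
  (sym (trans (cong s132 (s132-state₀ r c)) (s132-state₁ r c)))
  (subst (λ m → Spiral 2 m (state₂ r c)) (trans (sym eq) (+-identityʳ m)) (spiral-state₂ r c))
spiral-iter r c (suc i) m eq = spiral-step (spiral-iter r c i (suc m) (trans (sym (+-suc m i)) eq))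

state₀-¬avoidsBoth : ∀ r c → ¬ AvoidsBoth (state₀ r c)
state₀-¬avoidsBoth r c (avoids , _) = 1+n≰n
  (avoids⇒av132 avoids (++⁺ˡ (above₀ r c) (++⁺ˡ (triples c) ⊆-refl)) (s≤s (s≤s z≤n)))

state₁-¬avoidsBoth : ∀ r c → ¬ AvoidsBoth (state₁ r c)
state₁-¬avoidsBoth r c (_ , avoids) = 1+n≰n
  (avoids⇒av231 avoids (++⁺ˡ (above₁ r c) (++⁺ˡ (pairs c) (refl ∷ refl ∷ refl ∷ minimum _))) (s≤s (s≤s z≤n)))

not-before : ∀ r c u → u < 2 + (value r + c * 3) → ¬ AvoidsBoth (iter u s132 (state₀ r c))
not-before r c zero _ = state₀-¬avoidsBoth r c
not-before r c (suc zero) _ = subst (¬_ ∘ AvoidsBoth) (sym (s132-state₀ r c)) (state₁-¬avoidsBoth r c)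
-- For such an iterate `2 + o` entries are still outside the core, where `o` is the slack in
-- `i < value r + c * 3`.
not-before r c (suc (suc i)) (s≤s (s≤s i<q)) with m≤n⇒∃[o]m+o≡n i<q
... | o , eq = spiral-¬avoidsBoth (spiral-iter r c i (2 + o)
  (cong suc (trans (cong suc (+-comm o i)) eq)))

-- The starting permutation for each length, and the two bounds together

range : ℕ → List ℕ
range n = map suc (upTo n)

range-suc : ∀ n → suc n ∷ range n ↭ range (suc n)
range-suc n = ↭-trans (++-comm [ suc n ] (range n))
  (↭-reflexive (trans (sym (map-++ suc (upTo n) [ n ])) (cong (map suc) (upTo-∷ʳ n))))

triples-perm : ∀ c → triples c ++ 1 ∷ 3 ∷ 2 ∷ [] ↭ range (3 + c * 3)
triples-perm zero = prep 1 (++-comm [ 3 ] [ 2 ])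
triples-perm (suc c) = ↭-trans
  (↭-trans (swap (ap 4 c) (ap 6 c) ↭-refl) (prep (ap 6 c) (swap (ap 4 c) (ap 5 c) (triples-perm c))))
  (↭-trans (prep (ap 6 c) (prep (ap 5 c) (range-suc (3 + c * 3))))
    (↭-trans (prep (ap 6 c) (range-suc (4 + c * 3))) (range-suc (5 + c * 3))))

state₀-perm : ∀ r c → IsPerm (3 + (value r + c * 3)) (state₀ r c)
state₀-perm r0 c = triples-perm c
state₀-perm r1 c = ↭-trans (prep (ap 4 c) (triples-perm c)) (range-suc (3 + c * 3))
state₀-perm r2 c = ↭-trans (swap (ap 4 c) (ap 5 c) (triples-perm c))
  (↭-trans (prep (ap 5 c) (range-suc (3 + c * 3))) (range-suc (4 + c * 3)))

residue : ∀ m → ∃[ r ] ∃[ c ] m ≡ value r + c * 3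
residue zero = r0 , 0 , refl
residue (suc zero) = r1 , 0 , refl
residue (suc (suc zero)) = r2 , 0 , refl
residue (suc (suc (suc m))) with residue m
... | r , c , refl = r , suc c , sym (ap-suc (value r) c)

theorem7p2 : (n : ℕ) → 3 ≤ n →
    ((π : List ℕ) → IsPerm n π → ∃[ t ] (t ≤ n ∸ 1 × SdIs π t))
    × (∃[ π ] (IsPerm n π × SdIs π (n ∸ 1)))
theorem7p2 (suc (suc (suc m))) (s≤s (s≤s (s≤s z≤n))) = upper , lower
  where
  upper : (π : List ℕ) → IsPerm (3 + m) π → ∃[ t ] (t ≤ 2 + m × SdIs π t)
  upper π perm = least (λ t → avoidsBoth? (iter t s132 π)) (2 + m) (avoidsBoth-iter perm)
  lower : ∃[ π ] (IsPerm (3 + m) π × SdIs π (2 + m))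
  lower with residue m
  ... | r , c , refl = state₀ r c , state₀-perm r c ,
    avoidsBoth-iter (state₀-perm r c) , not-before r c
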